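{- Let $k$ be a positive integer and let $G$ be an edge-colored graph on $n$ vertices such that $m(G)+c(G)\geq \binom{n+1}{2}+k-1$. Then $G$ contains (at least) $k$ rainbow triangles.
   Context: Graphs are finite, simple, undirected and have at least one vertex. An edge-colored graph is a graph together with an arbitrary (not necessarily proper) assignment of a color to each edge. $m(G)$ denotes the number of edges of $G$, and $c(G)$ denotes the number of distinct colors that actually appear on the edges of $G$. A subgraph is rainbow if all its edges have pairwise distinct colors; a rainbow triangle is a rainbow subgraph isomorphic to $K_3$, and rainbow triangles are counted as distinct subgraphs (i.e. by their vertex sets). -}

module Defs where

open import Data.Fin.Base using (Fin; _<_)
open import Data.Fin.Properties using (_<?_; <-trans)
open import Data.List.Base
  using (List; []; _∷_; length; map; mapMaybe; filter; deduplicate;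
         allFin; cartesianProduct)
open import Data.List.Relation.Unary.Unique.Propositional using (Unique)
import Data.List.Relation.Unary.Unique.DecPropositional as DecUnique
open import Data.Maybe.Base using (Maybe)
import Data.Maybe.Base as Maybe
open import Data.Nat.Base using (ℕ)
open import Data.Product.Base using (_×_; _,_)
open import Relation.Binary.Definitions
  using (Decidable; DecidableEquality; Symmetric)
open import Relation.Binary.PropositionalEquality.Core using (_≡_)
open import Relation.Nullary.Decidable using (Dec; dec⇒maybe; _×-dec_)
open import Relation.Nullary.Negation.Core using (¬_)

record Graph (n : ℕ) : Set₁ where
  field
    Adj    : Fin n → Fin n → Set
    adj?   : Decidable Adj
    sym    : Symmetric Adj
    irrefl : ∀ {v} → ¬ Adj v v

  -- An undirected edge is represented by its increasing pair of endpoints.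
  record Edge : Set where
    eta-equality
    constructor mkEdge
    field
      {u v} : Fin n
      u<v   : u < v
      uv    : Adj u v

  edgeOn : Fin n × Fin n → Maybe Edge
  edgeOn (u , v) = Maybe.map (λ (u<v , uv) → mkEdge u<v uv)
    (dec⇒maybe (u <? v ×-dec adj? u v))

  -- Adj need not be proof-irrelevant, so Edge itself may have several
  -- inhabitants per pair of endpoints; the list has exactly one for each
  -- adjacent pair.
  edges : List Edge
  edges = mapMaybe edgeOn (cartesianProduct (allFin n) (allFin n))

  m : ℕ
  m = length edges

  -- Increasing vertices make each triangle determined by its vertex set.
  record Triangle : Set where
    eta-equality
    constructor mkTriangle
    field
      {u v w} : Fin n
      u<v     : u < v
      v<w     : v < w
      uv      : Adj u v
      vw      : Adj v w
      uw      : Adj u w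

  triangleEdges : Triangle → List Edge
  triangleEdges (mkTriangle u<v v<w uv vw uw) =
    mkEdge u<v uv ∷ mkEdge v<w vw ∷ mkEdge (<-trans u<v v<w) uw ∷ []

  triangleOn : Fin n × Fin n × Fin n → Maybe Triangle
  triangleOn (u , v , w) =
    Maybe.map (λ (u<v , v<w , uv , vw , uw) → mkTriangle u<v v<w uv vw uw)
      (dec⇒maybe (u <? v ×-dec v <? w ×-dec
                  adj? u v ×-dec adj? v w ×-dec adj? u w))

  -- As with edges, one entry for each vertex set.
  triangles : List Triangle
  triangles = mapMaybe triangleOn
    (cartesianProduct (allFin n) (cartesianProduct (allFin n) (allFin n)))

record EdgeColouring {n : ℕ} (G : Graph n) (Colour : Set) : Set where
  open Graph G
  field
    colour     : ∀ {u v} → Adj u v → Colour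
    -- Applied twice, this also makes colour independent of the adjacency proof.
    colour-sym : ∀ {u v} (p : Adj u v) (q : Adj v u) → colour p ≡ colour q

  edgeColour : Edge → Colour
  edgeColour e = colour (Edge.uv e)

  Rainbow : List Edge → Set
  Rainbow es = Unique (map edgeColour es)

  module _ (_≟_ : DecidableEquality Colour) where

    c : ℕ
    c = length (deduplicate _≟_ (map edgeColour edges))

    rainbow? : (es : List Edge) → Dec (Rainbow es)
    rainbow? es = DecUnique.unique? _≟_ (map edgeColour es)

    rainbowTriangles : List Triangle
    rainbowTriangles = filter (λ t → rainbow? (triangleEdges t)) triangles

{-# OPTIONS --safe #-}
-- The inequality m + c < C(n+1, 2) + t, where t is the number of rainbow
-- triangles, follows by repeatedly deleting a vertex v of minimum degree.
-- Let s be the number of colours occurring only at v, and choose for each of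
-- them a neighbour joined to v in that colour; let x be one of these s
-- neighbours.  Each of the others is either not adjacent to x or forms a
-- rainbow triangle with v and x, because the edge from it to x avoids v.
-- So s ≤ (n - d(x)) + t(v), and d(v) ≤ d(x) gives d(v) + s ≤ n + t(v), which
-- is what deleting v costs.
module Submission where

open import Defs
open import Data.Empty using (⊥-elim)
open import Data.Fin.Base using (Fin; _<_)
open import Data.Fin.Properties using (_<?_; <-cmp; <-asym)
  renaming (_≟_ to _≟ᶠ_)
open import Data.List.Base
  using (List; []; _∷_; _++_; length; map; mapMaybe; filter; deduplicate;
         allFin)
open import Data.List.Extrema.Nat using (argmin; argmin-sel; f[argmin]≤f[⊤]; f[argmin]≤f[xs])
open import Data.List.Membership.Propositional using (_∈_; find; lose)
open import Data.List.Membership.Propositional.Properties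
  using (∈-∃++; ∈-filter⁺; ∈-filter⁻; ∈-++⁺ˡ; ∈-++⁺ʳ; ∈-allFin; ∈-map⁻;
         ∈-deduplicate⁻; ∈-cartesianProduct⁺)
open import Data.List.Properties using (length-map; length-++; length-tabulate)
open import Data.List.Relation.Binary.Permutation.Propositional
  using (_↭_; prep; swap; ↭-refl; ↭-sym; ↭-trans)
open import Data.List.Relation.Binary.Permutation.Propositional.Properties
  using (∈-resp-↭; ↭-length; shift; drop-∷; ↭-singleton-inv)
open import Data.List.Relation.Unary.All as All using (All; []; _∷_)
import Data.List.Relation.Unary.All.Properties as All
open import Data.List.Relation.Unary.AllPairs as AllPairs using (AllPairs; []; _∷_)
import Data.List.Relation.Unary.AllPairs.Properties as AllPairs
open import Data.List.Relation.Unary.Any using (here; there; any?)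
open import Data.List.Relation.Unary.Unique.Propositional using (Unique)
import Data.List.Relation.Unary.Unique.Propositional.Properties as Unique
import Data.List.Relation.Unary.Unique.DecPropositional.Properties as DecUnique
open import Data.Maybe.Base as Maybe using (Maybe; just; nothing)
open import Data.Nat.Base using (ℕ; zero; suc; _+_; _∸_; _≤_; _≥_; z≤n; s≤s)
  renaming (_<_ to _<ⁿ_)
open import Data.Nat.Combinatorics using (_C_; nC1≡n; nCk+nC[k+1]≡[n+1]C[k+1])
open import Data.Nat.Properties
  using (≤-trans; ≤-reflexive; ≤-antisym; suc-injective; +-suc; +-comm; +-assoc;
         +-mono-≤; +-mono-≤-<; +-monoˡ-≤; +-monoʳ-≤; +-cancelˡ-<; m≤m+n;
         module ≤-Reasoning)
open import Data.Nat.Solver using (module +-*-Solver)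
open import Data.Product.Base using (Σ; ∃; ∃₂; _×_; _,_; proj₁; proj₂)
open import Data.Sum.Base using (_⊎_; inj₁; inj₂)
open import Function.Base using (_∘_)
open import Relation.Binary.Definitions using (DecidableEquality; tri<; tri≈; tri>)
open import Relation.Binary.PropositionalEquality
  using (_≡_; _≢_; refl; sym; trans; cong; cong₂; subst)
open import Relation.Nullary.Decidable
  using (Dec; yes; no; ¬?; _×-dec_; map′; dec⇒maybe)
open import Relation.Nullary.Negation.Core using (¬_)
open import Relation.Unary using (Decidable)

-- Counting along lists.

module _ {A : Set} where

  filter-split : {P : A → Set} (P? : Decidable P) (xs : List A) →
    length (filter P? xs) + length (filter (¬? ∘ P?) xs) ≡ length xs
  filter-split P? [] = refl
  filter-split P? (x ∷ xs) with P? x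
  ... | yes _ = cong suc (filter-split P? xs)
  ... | no  _ = trans (+-suc _ _) (cong suc (filter-split P? xs))

  -- The retraction `g` makes `f` injective wherever it is defined. Uniqueness is asserted after
  -- applying `g` so that edges are compared by their endpoints and not by their proofs of
  -- adjacency.
  mapMaybe-unique : {B : Set} {f : A → Maybe B} {g : B → A} →
    (∀ {x y} → f x ≡ just y → g y ≡ x) →
    ∀ {xs} → Unique xs → Unique (map g (mapMaybe f xs))
  mapMaybe-unique {B} {f} {g} retract = go
    where
    fresh : ∀ {x xs} → All (x ≢_) xs → All (x ≢_) (map g (mapMaybe f xs))
    fresh [] = []
    fresh {xs = y ∷ _} (x≢y ∷ x≢xs) with f y in eq
    ... | just _  = (λ x≡gz → x≢y (trans x≡gz (retract eq))) ∷ fresh x≢xs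
    ... | nothing = fresh x≢xs

    go : ∀ {xs} → Unique xs → Unique (map g (mapMaybe f xs))
    go [] = []
    go {x ∷ xs} (x≢xs ∷ xs!) with f x in eq
    ... | just _  = subst (λ z → All (z ≢_) (map g (mapMaybe f xs)))
                      (sym (retract eq)) (fresh x≢xs) ∷ go xs!
    ... | nothing = go xs!

  ∈-mapMaybe : {B : Set} {f : A → Maybe B} {x : A} {y : B} {xs : List A} →
    x ∈ xs → f x ≡ just y → y ∈ mapMaybe f xs
  ∈-mapMaybe {f = f} {x} (here refl) eq with f x | eq
  ... | _ | refl = here refl
  ∈-mapMaybe {f = f} {xs = z ∷ _} (there x∈xs) eq with f z
  ... | just _  = there (∈-mapMaybe x∈xs eq)
  ... | nothing = ∈-mapMaybe x∈xs eq

  -- Remove from `ys` the partner of the head; no later element is related to it, so the tail still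
  -- finds its partners in what is left. A relation in place of a function avoids fixing a choice of
  -- images.
  pigeonhole : {B : Set} {R : A → B → Set} {xs : List A} {ys : List B} →
    AllPairs (λ x x′ → ∀ y → R x y → ¬ R x′ y) xs →
    (∀ {x} → x ∈ xs → ∃ λ y → y ∈ ys × R x y) →
    length xs ≤ length ys
  pigeonhole [] _ = z≤n
  pigeonhole {R = R} {x ∷ xs} (x# ∷ xs#) image with image (here refl)
  ... | y , y∈ys , Rxy with ∈-∃++ y∈ys
  ... | as , bs , refl =
    ≤-trans (s≤s (pigeonhole xs# image′))
      (≤-reflexive (sym (↭-length (shift y as bs))))
    where
    image′ : ∀ {x′} → x′ ∈ xs → ∃ λ z → z ∈ as ++ bs × R x′ z
    image′ x′∈xs with image (there x′∈xs)
    ... | z , z∈ys , Rx′z with ∈-resp-↭ (shift y as bs) z∈ys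
    ... | here refl = ⊥-elim (All.lookup x# x′∈xs y Rxy Rx′z)
    ... | there z∈  = z , z∈ , Rx′z

dec⇒just : {A : Set} (d : Dec A) → A → ∃ λ a → dec⇒maybe d ≡ just a
dec⇒just (yes a) _ = a , refl
dec⇒just (no ¬a) a = ⊥-elim (¬a a)

-- Edge colours and rainbow triples on vertices.

module _ {n : ℕ} {G : Graph n} {Colour : Set} (χ : EdgeColouring G Colour)
         (_≟_ : DecidableEquality Colour) where

  open Graph G renaming (sym to adj-sym)
  open EdgeColouring χ

  Vertex : Set
  Vertex = Fin n

  colour-irr : ∀ {a b} (p q : Adj a b) → colour p ≡ colour q
  colour-irr p q = trans (colour-sym p (adj-sym p)) (colour-sym (adj-sym p) q)

  Hue : Vertex → Vertex → Colour → Set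
  Hue a b κ = Σ (Adj a b) λ p → colour p ≡ κ

  hue? : ∀ a b κ → Dec (Hue a b κ)
  hue? a b κ with adj? a b
  ... | no ¬p = no (¬p ∘ proj₁)
  ... | yes p = map′ (p ,_) (λ (q , eq) → trans (colour-irr p q) eq) (colour p ≟ κ)

  hue-sym : ∀ {a b κ} → Hue a b κ → Hue b a κ
  hue-sym (p , eq) = adj-sym p , trans (colour-sym (adj-sym p) p) eq

  hue-functional : ∀ {a b κ μ} → Hue a b κ → Hue a b μ → κ ≡ μ
  hue-functional (p , refl) (q , refl) = colour-irr p q

  adj⇒≢ : ∀ {a b} → Adj a b → a ≢ b
  adj⇒≢ p refl = irrefl p

  Appears : List Vertex → Colour → Set
  Appears S κ = ∃₂ λ a b → a ∈ S × b ∈ S × Hue a b κ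

  appears? : ∀ S → Decidable (Appears S)
  appears? S κ = map′
    (λ p → let a , a∈S , q = find p
               b , b∈S , h = find q
           in a , b , a∈S , b∈S , h)
    (λ (a , b , a∈S , b∈S , h) → lose a∈S (lose b∈S h))
    (any? (λ a → any? (λ b → hue? a b κ) S) S)

  -- The vertices come in no prescribed order, so a triangle can be written down with the deleted
  -- vertex first; sorting is postponed to the end.
  RainbowTriple : Vertex × Vertex × Vertex → Set
  RainbowTriple (a , b , c) = ∃ λ α → ∃ λ β → ∃ λ γ →
    Hue a b α × Hue b c β × Hue a c γ × α ≢ β × α ≢ γ × β ≢ γ

  swap₁₂ : ∀ {a b c} → RainbowTriple (a , b , c) → RainbowTriple (b , a , c)
  swap₁₂ (α , β , γ , hab , hbc , hac , α≢β , α≢γ , β≢γ) =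
    α , γ , β , hue-sym hab , hac , hbc , α≢γ , α≢β , β≢γ ∘ sym

  swap₂₃ : ∀ {a b c} → RainbowTriple (a , b , c) → RainbowTriple (a , c , b)
  swap₂₃ (α , β , γ , hab , hbc , hac , α≢β , α≢γ , β≢γ) =
    γ , β , α , hac , hue-sym hbc , hab , β≢γ ∘ sym , α≢γ ∘ sym , α≢β ∘ sym

  vertices : Vertex × Vertex × Vertex → List Vertex
  vertices (a , b , c) = a ∷ b ∷ c ∷ []

  EdgeIn : List Vertex → Vertex × Vertex → Set
  EdgeIn S (a , b) = a < b × Adj a b × a ∈ S × b ∈ S

  TriangleIn : List Vertex → Vertex × Vertex × Vertex → Set
  TriangleIn S τ = RainbowTriple τ × All (_∈ S) (vertices τ)

  -- A triple is just one ordering of its vertex set, so triangles are told apart up to permutation.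
  DistinctTriangles : List (Vertex × Vertex × Vertex) → Set
  DistinctTriangles = AllPairs (λ τ τ′ → ¬ (vertices τ ↭ vertices τ′))

  -- Induced degrees and vertex deletion.

  degree : List Vertex → Vertex → ℕ
  degree S v = length (filter (adj? v) S)

  infixl 6 _∖_
  _∖_ : List Vertex → Vertex → List Vertex
  S ∖ v = filter (λ a → ¬? (a ≟ᶠ v)) S

  ∈-∖⁺ : ∀ {S v a} → a ∈ S → a ≢ v → a ∈ S ∖ v
  ∈-∖⁺ {v = v} = ∈-filter⁺ (λ a → ¬? (a ≟ᶠ v))

  ∈-∖⁻ : ∀ {S v a} → a ∈ S ∖ v → a ∈ S × a ≢ v
  ∈-∖⁻ {v = v} = ∈-filter⁻ (λ a → ¬? (a ≟ᶠ v))

  ∖-unique : ∀ {S} v → Unique S → Unique (S ∖ v)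
  ∖-unique v = Unique.filter⁺ (λ a → ¬? (a ≟ᶠ v))

  -- The filter drops every copy of `v`, and uniqueness ensures that this is a single one. Both
  -- inequalities come from matching equal elements.
  length-∖ : ∀ {S v} → Unique S → v ∈ S → length S ≡ suc (length (S ∖ v))
  length-∖ {S} {v} S! v∈S = ≤-antisym
    (pigeonhole (AllPairs.map (λ { x≢y _ refl refl → x≢y refl }) S!) to)
    (pigeonhole {R = _≡_}
      (AllPairs.map (λ { x≢y _ refl refl → x≢y refl })
        (All.tabulate (λ a∈ v≡a → proj₂ (∈-∖⁻ {S} a∈) (sym v≡a)) ∷ ∖-unique v S!))
      from)
    where
    to : ∀ {a} → a ∈ S → ∃ λ b → b ∈ v ∷ S ∖ v × a ≡ b
    to {a} a∈S with a ≟ᶠ v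
    ... | yes a≡v = v , here refl , a≡v
    ... | no a≢v  = a , there (∈-∖⁺ a∈S a≢v) , refl

    from : ∀ {a} → a ∈ v ∷ S ∖ v → ∃ λ b → b ∈ S × a ≡ b
    from (here refl) = v , v∈S , refl
    from (there a∈)  = _ , proj₁ (∈-∖⁻ a∈) , refl

  minimumDegree : ∀ x S → ∃ λ v → v ∈ x ∷ S ×
    (∀ {y} → y ∈ x ∷ S → degree (x ∷ S) v ≤ degree (x ∷ S) y)
  minimumDegree x S = v , v∈ , least
    where
    d : Vertex → ℕ
    d = degree (x ∷ S)
    v : Vertex
    v = argmin d x S
    v∈ : v ∈ x ∷ S
    v∈ with argmin-sel d x S
    ... | inj₁ v≡x = here v≡x
    ... | inj₂ v∈S = there v∈S
    least : ∀ {y} → y ∈ x ∷ S → d v ≤ d y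
    least (here refl) = f[argmin]≤f[⊤] {f = d} x S
    least (there y∈S) = All.lookup (f[argmin]≤f[xs] {f = d} x S) y∈S

  -- Colours lost with a deleted vertex, and the triangles they force.

  Saturated : List Vertex → Vertex → Colour → Set
  Saturated S v κ = (∃ λ y → y ∈ S × Hue v y κ) × ¬ Appears (S ∖ v) κ

  -- An edge of colour `κ` missing `v` would survive the deletion, so any witness of its appearance
  -- has `v` as an end; the other end is the required neighbour.
  appears⇒saturated : ∀ {S v κ} → Appears S κ → ¬ Appears (S ∖ v) κ → Saturated S v κ
  appears⇒saturated {S} {v} {κ} (a , b , a∈S , b∈S , h) absent = at (a ≟ᶠ v) (b ≟ᶠ v) , absent
    where
    at : Dec (a ≡ v) → Dec (b ≡ v) → ∃ λ y → y ∈ S × Hue v y κ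
    at (yes refl) _          = b , b∈S , h
    at (no _)     (yes refl) = a , a∈S , hue-sym h
    at (no a≢v)   (no b≢v)   =
      ⊥-elim (absent (a , b , ∈-∖⁺ a∈S a≢v , ∈-∖⁺ b∈S b≢v , h))

  trianglesAt : ∀ {S v} → Unique S → v ∈ S →
    (∀ {y} → y ∈ S → degree S v ≤ degree S y) →
    ∀ Ks → Unique Ks → All (Saturated S v) Ks →
    ∃ λ Ts → DistinctTriangles Ts ×
      All (λ τ → TriangleIn S τ × v ∈ vertices τ) Ts ×
      degree S v + length Ks ≤ length S + length Ts
  trianglesAt {S} {v} _ _ _ [] _ _ =
    [] , [] , [] ,
    +-monoˡ-≤ 0 (≤-trans (m≤m+n _ _) (≤-reflexive (filter-split (adj? v) S)))
  trianglesAt {S} {v} S! v∈S least (κ ∷ Ks) (κ≢Ks ∷ Ks!) (((x , x∈S , hvx) , κ-absent) ∷ sat) =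
    map triple B ,
    AllPairs.map⁺ (AllPairs.map distinct (Unique.filter⁺ good? S!)) ,
    All.map⁺ (All.tabulate rainbow) ,
    count
    where
    -- No representative is chosen per colour: every neighbour of `x` joined to `v` in a colour of
    -- `Ks` is kept, since each of them gives a rainbow triangle.
    Good : Vertex → Set
    Good y = Adj x y × ∃ λ μ → μ ∈ Ks × Hue v y μ

    good? : Decidable Good
    good? y = adj? x y ×-dec map′ find (λ (_ , ∈Ks , h) → lose ∈Ks h) (any? (hue? v y) Ks)

    A B : List Vertex
    A = filter (¬? ∘ adj? x) S
    B = filter good? S

    triple : Vertex → Vertex × Vertex × Vertex
    triple y = v , x , y

    distinct : ∀ {y y′} → y ≢ y′ → ¬ (vertices (triple y) ↭ vertices (triple y′))
    distinct y≢y′ perm with ↭-singleton-inv (drop-∷ (drop-∷ perm))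
    ... | refl = y≢y′ refl

    rainbow : ∀ {y} → y ∈ B → TriangleIn S (triple y) × v ∈ vertices (triple y)
    rainbow {y} y∈B with ∈-filter⁻ good? {xs = S} y∈B
    ... | y∈S , xy , μ , μ∈Ks , hvy =
      ((κ , colour xy , μ , hvx , (xy , refl) , hvy ,
        (λ { refl → κ-absent (seen refl) }) ,
        All.lookup κ≢Ks μ∈Ks ,
        (λ eq → proj₂ (All.lookup sat μ∈Ks) (seen eq))) ,
       v∈S ∷ x∈S ∷ y∈S ∷ []) ,
      here refl
      where
      seen : ∀ {ν} → colour xy ≡ ν → Appears (S ∖ v) ν
      seen eq = x , y , ∈-∖⁺ x∈S (adj⇒≢ (proj₁ hvx) ∘ sym) ,
                ∈-∖⁺ y∈S (adj⇒≢ (proj₁ hvy) ∘ sym) , xy , eq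

    image : ∀ {μ} → μ ∈ κ ∷ Ks → ∃ λ y → y ∈ A ++ B × Hue v y μ
    -- `x` is a non-neighbour of itself, so `A` already accounts for the colour `κ` and the bound
    -- carries no extra one.
    image (here refl) = x , ∈-++⁺ˡ (∈-filter⁺ (¬? ∘ adj? x) x∈S irrefl) , hvx
    image (there μ∈Ks) with All.lookup sat μ∈Ks
    ... | (y , y∈S , hvy) , _ with adj? x y
    ... | yes xy = y , ∈-++⁺ʳ A (∈-filter⁺ good? y∈S (xy , _ , μ∈Ks , hvy)) , hvy
    ... | no ¬xy = y , ∈-++⁺ˡ (∈-filter⁺ (¬? ∘ adj? x) y∈S ¬xy) , hvy

    open ≤-Reasoning
    count : degree S v + length (κ ∷ Ks) ≤ length S + length (map triple B)
    count = begin
      degree S v + length (κ ∷ Ks)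
        ≤⟨ +-mono-≤ (least x∈S)
             (pigeonhole {R = λ μ y → Hue v y μ}
               (AllPairs.map (λ κ≢μ _ h h′ → κ≢μ (hue-functional h h′)) (κ≢Ks ∷ Ks!))
               image) ⟩
      degree S x + length (A ++ B)
        ≡⟨ cong (degree S x +_) (length-++ A) ⟩
      degree S x + (length A + length B)
        ≡⟨ +-assoc (degree S x) _ _ ⟨
      degree S x + length A + length B
        ≡⟨ cong₂ _+_ (filter-split (adj? x) S) (sym (length-map triple B)) ⟩
      length S + length (map triple B) ∎

  -- Induction on the number of vertices.

  Avoids : Vertex → Vertex × Vertex → Set
  Avoids v (a , b) = a ≢ v × b ≢ v

  avoids? : ∀ v → Decidable (Avoids v)
  avoids? v (a , b) = ¬? (a ≟ᶠ v) ×-dec ¬? (b ≟ᶠ v)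

  incident≤degree : ∀ {S} v {Es} → Unique Es → All (EdgeIn S) Es →
    length (filter (¬? ∘ avoids? v) Es) ≤ degree S v
  incident≤degree {S} v {Es} Es! Es⊆S =
    pigeonhole {R = OtherEnd}
      (AllPairs.map (λ e≢e′ _ r r′ → e≢e′ (injective r r′))
        (Unique.filter⁺ (¬? ∘ avoids? v) Es!))
      image
    where
    -- Recording `a < b` makes the other end determine the edge: otherwise the pairs `(v , y)` and
    -- `(y , v)` would share `y`.
    OtherEnd : Vertex × Vertex → Vertex → Set
    OtherEnd (a , b) y = a < b × (a ≡ v × b ≡ y ⊎ b ≡ v × a ≡ y)

    injective : ∀ {e e′ y} → OtherEnd e y → OtherEnd e′ y → e ≡ e′
    injective (_ , inj₁ (refl , refl)) (_ , inj₁ (refl , refl)) = refl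
    injective (_ , inj₂ (refl , refl)) (_ , inj₂ (refl , refl)) = refl
    injective (p , inj₁ (refl , refl)) (q , inj₂ (refl , refl)) = ⊥-elim (<-asym p q)
    injective (p , inj₂ (refl , refl)) (q , inj₁ (refl , refl)) = ⊥-elim (<-asym p q)

    image : ∀ {e} → e ∈ filter (¬? ∘ avoids? v) Es →
      ∃ λ y → y ∈ filter (adj? v) S × OtherEnd e y
    image {a , b} e∈ with ∈-filter⁻ (¬? ∘ avoids? v) {xs = Es} e∈
    ... | e∈Es , meets with All.lookup Es⊆S e∈Es | a ≟ᶠ v | b ≟ᶠ v
    ... | a<b , ab , _ , b∈S | yes refl | _ =
      b , ∈-filter⁺ (adj? v) b∈S ab , a<b , inj₁ (refl , refl)
    ... | a<b , ab , a∈S , _ | no _ | yes refl =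
      a , ∈-filter⁺ (adj? v) a∈S (adj-sym ab) , a<b , inj₂ (refl , refl)
    ... | _ | no a≢v | no b≢v = ⊥-elim (meets (a≢v , b≢v))

  -- Stated for arbitrary lists of edges and colours, so that passing to an
  -- induced subgraph is just filtering.
  manyTriangles : ∀ s {S} → Unique S → length S ≡ suc s →
    ∀ {Es} → Unique Es → All (EdgeIn S) Es →
    ∀ {Ks} → Unique Ks → All (Appears S) Ks →
    ∃ λ Ts → DistinctTriangles Ts × All (TriangleIn S) Ts ×
      length Es + length Ks <ⁿ suc (suc s) C 2 + length Ts
  -- The strictness originates here: a single vertex carries no edge and no colour, while `2 C 2` is
  -- 1.
  manyTriangles zero {x ∷ []} _ _ {[]} _ _ {[]} _ _ = [] , [] , [] , s≤s z≤n
  manyTriangles zero {x ∷ []} _ _ {[]} _ _ {_ ∷ _} _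
    ((_ , _ , here refl , here refl , h) ∷ _) = ⊥-elim (irrefl (proj₁ h))
  manyTriangles zero {x ∷ []} _ _ {_ ∷ _} _ ((_ , xx , here refl , here refl) ∷ _) =
    ⊥-elim (irrefl xx)
  manyTriangles (suc s) {S@(x ∷ xs)} S! |S| {Es} Es! Es⊆S {Ks} Ks! Ks⊆S =
    T₁ ++ T₂ ,
    AllPairs.++⁺ T₁# T₂# (All.map (λ (_ , v∈τ) → All.map (apart v∈τ) T₂⊆S′) T₁⊆S) ,
    All.++⁺ (All.map proj₁ T₁⊆S)
      (All.map (λ (r , τ⊆S′) → r , All.map (proj₁ ∘ ∈-∖⁻) τ⊆S′) T₂⊆S′) ,
    total
    where
    choice = minimumDegree x xs
    v = proj₁ choice
    v∈S = proj₁ (proj₂ choice)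
    S′ = S ∖ v

    -- Index 1 marks what is lost with `v`, index 2 what is handed to the induction hypothesis on
    -- `S′`.
    E₁ = filter (¬? ∘ avoids? v) Es
    E₂ = filter (avoids? v) Es
    K₁ = filter (¬? ∘ appears? S′) Ks
    K₂ = filter (appears? S′) Ks

    K₁-saturated : ∀ {κ} → κ ∈ K₁ → Saturated S v κ
    K₁-saturated κ∈ with ∈-filter⁻ (¬? ∘ appears? S′) {xs = Ks} κ∈
    ... | κ∈Ks , absent = appears⇒saturated (All.lookup Ks⊆S κ∈Ks) absent

    E₂⊆S′ : ∀ {e} → e ∈ E₂ → EdgeIn S′ e
    E₂⊆S′ e∈ with ∈-filter⁻ (avoids? v) {xs = Es} e∈
    ... | e∈Es , a≢v , b≢v with All.lookup Es⊆S e∈Es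
    ... | a<b , ab , a∈S , b∈S = a<b , ab , ∈-∖⁺ a∈S a≢v , ∈-∖⁺ b∈S b≢v

    atV = trianglesAt S! v∈S (proj₂ (proj₂ choice)) K₁
            (Unique.filter⁺ (¬? ∘ appears? S′) Ks!) (All.tabulate K₁-saturated)
    T₁ = proj₁ atV
    T₁# = proj₁ (proj₂ atV)
    T₁⊆S = proj₁ (proj₂ (proj₂ atV))

    rest = manyTriangles s (∖-unique v S!)
             (suc-injective (trans (sym (length-∖ S! v∈S)) |S|))
             (Unique.filter⁺ (avoids? v) Es!) (All.tabulate E₂⊆S′)
             (Unique.filter⁺ (appears? S′) Ks!) (All.all-filter (appears? S′) Ks)
    T₂ = proj₁ rest
    T₂# = proj₁ (proj₂ rest)
    T₂⊆S′ = proj₁ (proj₂ (proj₂ rest))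

    -- The triangles of `T₁` contain `v` and those of `T₂` lie in `S′`, so none is counted twice.
    apart : ∀ {τ τ′} → v ∈ vertices τ → TriangleIn S′ τ′ → ¬ (vertices τ ↭ vertices τ′)
    apart v∈τ (_ , τ′⊆S′) perm =
      proj₂ (∈-∖⁻ {S} (All.lookup τ′⊆S′ (∈-resp-↭ perm v∈τ))) refl

    open ≤-Reasoning
    open +-*-Solver using (solve; _:+_; _:=_)

    interchange : ∀ a b c d → (a + b) + (c + d) ≡ (b + d) + (a + c)
    interchange = solve 4 (λ a b c d → (a :+ b) :+ (c :+ d) := (b :+ d) :+ (a :+ c)) refl

    total : length Es + length Ks <ⁿ suc (suc (suc s)) C 2 + length (T₁ ++ T₂)
    total = begin-strict
      length Es + length Ks
        ≡⟨ cong₂ _+_ (filter-split (avoids? v) Es) (filter-split (appears? S′) Ks) ⟨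
      (length E₂ + length E₁) + (length K₂ + length K₁)
        ≡⟨ interchange (length E₂) (length E₁) (length K₂) (length K₁) ⟩
      (length E₁ + length K₁) + (length E₂ + length K₂)
        <⟨ +-mono-≤-<
             (≤-trans (+-monoˡ-≤ (length K₁) (incident≤degree v Es! Es⊆S))
               (proj₂ (proj₂ (proj₂ atV))))
             (proj₂ (proj₂ (proj₂ rest))) ⟩
      (length S + length T₁) + (suc (suc s) C 2 + length T₂)
        ≡⟨ solve 4 (λ a b c d → (a :+ b) :+ (c :+ d) := (a :+ c) :+ (b :+ d)) refl
             (length S) (length T₁) (suc (suc s) C 2) (length T₂) ⟩
      (length S + suc (suc s) C 2) + (length T₁ + length T₂)
        -- The cost of the deletion, `length S`, is rewritten as a binomial coefficient so that
        -- Pascal's rule yields the next bound.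
        ≡⟨ cong₂ (λ a b → (a + suc (suc s) C 2) + b)
             (trans |S| (sym (nC1≡n (suc (suc s))))) (sym (length-++ T₁)) ⟩
      (suc (suc s) C 1 + suc (suc s) C 2) + length (T₁ ++ T₂)
        ≡⟨ cong (_+ length (T₁ ++ T₂)) (nCk+nC[k+1]≡[n+1]C[k+1] (suc (suc s)) 1) ⟩
      suc (suc (suc s)) C 2 + length (T₁ ++ T₂) ∎

  -- From rainbow triples back to the listed triangles.

  endpoints : Edge → Vertex × Vertex
  endpoints e = Edge.u e , Edge.v e

  edgeOn-endpoints : ∀ {ab e} → edgeOn ab ≡ just e → endpoints e ≡ ab
  edgeOn-endpoints {a , b} eq
    with dec⇒maybe (a <? b ×-dec adj? a b) | eq
  ... | just _ | refl = refl

  corners : Triangle → Vertex × Vertex × Vertex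
  corners t = Triangle.u t , Triangle.v t , Triangle.w t

  Listed : Vertex × Vertex × Vertex → Set
  Listed τ = ∃ λ t → t ∈ rainbowTriangles _≟_ × vertices τ ↭ vertices (corners t)

  -- The listed triangle carries the adjacency proofs returned by the decision procedure, which may
  -- differ from those of the triple; the colours agree because a pair of vertices has only one.
  listed-< : ∀ {a b c} → a < b → b < c → RainbowTriple (a , b , c) → Listed (a , b , c)
  listed-< {a} {b} {c} a<b b<c
    (α , β , γ , hab@(ab , _) , hbc@(bc , _) , hac@(ac , _) , α≢β , α≢γ , β≢γ)
    with dec⇒just (a <? b ×-dec b <? c ×-dec
                   adj? a b ×-dec adj? b c ×-dec adj? a c)
           (a<b , b<c , ab , bc , ac)
  ... | (a<b′ , b<c′ , ab′ , bc′ , ac′) , eq =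
    mkTriangle a<b′ b<c′ ab′ bc′ ac′ ,
    ∈-filter⁺ (λ t → rainbow? _≟_ (triangleEdges t))
      (∈-mapMaybe
        (∈-cartesianProduct⁺ (∈-allFin a) (∈-cartesianProduct⁺ (∈-allFin b) (∈-allFin c)))
        (cong (Maybe.map _) eq))
      ((distinct hab hbc α≢β ∷ distinct hab hac α≢γ ∷ []) ∷ (distinct hbc hac β≢γ ∷ []) ∷ [] ∷ []) ,
    ↭-refl
    where
    distinct : ∀ {a b c d κ μ} {p : Adj a b} {q : Adj c d} →
      Hue a b κ → Hue c d μ → κ ≢ μ → colour p ≢ colour q
    distinct h h′ κ≢μ eq =
      κ≢μ (trans (hue-functional h (_ , refl)) (trans eq (hue-functional (_ , refl) h′)))

  listed-resp : ∀ {τ τ′} → vertices τ ↭ vertices τ′ → Listed τ′ → Listed τ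
  listed-resp perm (t , t∈ , perm′) = t , t∈ , ↭-trans perm perm′

  -- Insertion of `c` into the sorted pair `a`, `b`: it falls after, between or before them, and
  -- adjacency excludes equality.
  listed-<₁₂ : ∀ {a b c} → a < b → RainbowTriple (a , b , c) → Listed (a , b , c)
  listed-<₁₂ {a} {b} {c} a<b r@(_ , _ , _ , _ , (bc , _) , (ac , _) , _)
    with <-cmp b c | <-cmp a c
  ... | tri< b<c _ _ | _            = listed-< a<b b<c r
  ... | tri≈ _ b≡c _ | _            = ⊥-elim (adj⇒≢ bc b≡c)
  ... | tri> _ _ c<b | tri< a<c _ _ =
    listed-resp (prep a (swap b c ↭-refl)) (listed-< a<c c<b (swap₂₃ r))
  ... | tri> _ _ _   | tri≈ _ a≡c _ = ⊥-elim (adj⇒≢ ac a≡c)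
  ... | tri> _ _ _   | tri> _ _ c<a =
    listed-resp (↭-trans (prep a (swap b c ↭-refl)) (swap a c ↭-refl))
      (listed-< c<a a<b (swap₁₂ (swap₂₃ r)))

  listed : ∀ {a b c} → RainbowTriple (a , b , c) → Listed (a , b , c)
  listed {a} {b} {c} r@(_ , _ , _ , (ab , _) , _) with <-cmp a b
  ... | tri< a<b _ _ = listed-<₁₂ a<b r
  ... | tri≈ _ a≡b _ = ⊥-elim (adj⇒≢ ab a≡b)
  ... | tri> _ _ b<a = listed-resp (swap a b ↭-refl) (listed-<₁₂ b<a (swap₁₂ r))

  -- The induction is applied to all vertices, edges and colours. An equation stands in for matching
  -- on `n`, which is a parameter of the module.
  m+c<C+triangles : ∀ {s} → n ≡ suc s →
    m + c _≟_ <ⁿ suc n C 2 + length (rainbowTriangles _≟_)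
  m+c<C+triangles {s} n≡1+s = begin-strict
    m + c _≟_
      ≡⟨ cong (_+ c _≟_) (length-map endpoints edges) ⟨
    length (map endpoints edges) + c _≟_
      <⟨ proj₂ (proj₂ (proj₂ many)) ⟩
    suc (suc s) C 2 + length Ts
      ≤⟨ +-monoʳ-≤ (suc (suc s) C 2)
           -- Two triples matched to the same listed triangle would be permutations of each other,
           -- against their distinctness.
           (pigeonhole {R = λ τ t → vertices τ ↭ vertices (corners t)}
             (AllPairs.map (λ τ≉τ′ _ p p′ → τ≉τ′ (↭-trans p (↭-sym p′))) (proj₁ (proj₂ many)))
             (λ τ∈Ts → listed (proj₁ (All.lookup (proj₁ (proj₂ (proj₂ many))) τ∈Ts)))) ⟩
    suc (suc s) C 2 + length (rainbowTriangles _≟_)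
      ≡⟨ cong (λ k → suc k C 2 + length (rainbowTriangles _≟_)) n≡1+s ⟨
    suc n C 2 + length (rainbowTriangles _≟_) ∎
    where
    open ≤-Reasoning

    appear : ∀ {κ} → κ ∈ deduplicate _≟_ (map edgeColour edges) → Appears (allFin n) κ
    appear κ∈ with ∈-map⁻ edgeColour (∈-deduplicate⁻ _≟_ (map edgeColour edges) κ∈)
    ... | e , _ , refl = Edge.u e , Edge.v e , ∈-allFin _ , ∈-allFin _ , Edge.uv e , refl

    many = manyTriangles s (Unique.allFin⁺ n) (trans (length-tabulate _) n≡1+s)
      (mapMaybe-unique edgeOn-endpoints
        (Unique.cartesianProduct⁺ (Unique.allFin⁺ n) (Unique.allFin⁺ n)))
      (All.map⁺ (All.tabulate λ {e} _ → Edge.u<v e , Edge.uv e , ∈-allFin _ , ∈-allFin _))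
      (DecUnique.deduplicate-! _≟_ (map edgeColour edges))
      (All.tabulate appear)
    Ts = proj₁ many

theorem2 : (Colour : Set) (_≟_ : DecidableEquality Colour)
    (k : ℕ) → 1 ≤ k →
    (n : ℕ) → 1 ≤ n →
    (G : Graph n) (χ : EdgeColouring G Colour) →
    Graph.m G + EdgeColouring.c χ _≟_ ≥ ((n + 1) C 2) + (k ∸ 1) →
    k ≤ length (EdgeColouring.rainbowTriangles χ _≟_)
theorem2 Colour _≟_ (suc k) _ (suc n) _ G χ many =
  -- The positive integer is now `suc k`, so `k ∸ 1` has become `k`. Cancelling the binomial leaves
  -- `k` strictly below the number of rainbow triangles, which is the claim for `suc k`.
  +-cancelˡ-< (suc (suc n) C 2) k _
    (≤-trans (s≤s (subst (λ j → j C 2 + k ≤ Graph.m G + EdgeColouring.c χ _≟_)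
                    (+-comm (suc n) 1) many))
      (m+c<C+triangles χ _≟_ refl))
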